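{- For any $\ell,m\in\mathbb{N}$ with $\ell\neq m$, there is a $2$-coloring of $\mathbb{N}$ such that, for every infinite $B\subset\mathbb{N}$ and all $t_1,t_2\in\mathbb{Z}$, the set $$\{mx+\ell y+t_1:x,y\in B,\ x<y\}\cup\{mx+\ell y+t_2:x,y\in B,\ x>y\},$$ whenever it is contained in $\mathbb{N}$, is not monochromatic.
   Context: $\mathbb{N}=\{1,2,3,\ldots\}$. A $2$-coloring of a set $S$ is a map from $S$ to a set with two elements; a subset of $S$ is monochromatic if the coloring is constant on it. The coloring may depend on $m,\ell$ but not on $B,t_1,t_2$. -}

module Defs where

open import Data.Bool.Base using (Bool)
open import Data.Integer.Base using (ℤ; +_; _+_; _*_)
import Data.Nat.Base as ℕ
open import Data.List.Membership.Propositional using () renaming (_∈_ to _∈ₗ_)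
open import Data.Product.Base using (∃-syntax; _×_)
open import Data.Refinement using (Refinement-syntax; value)
open import Level using (0ℓ)
open import Relation.Binary.Core using (Rel)
open import Relation.Binary.PropositionalEquality.Core using (_≡_)
open import Relation.Nullary.Negation.Core using (¬_)
open import Relation.Unary using (Pred; _∈_)

ℕ⁺ : Set
ℕ⁺ = [ n ∈ ℕ.ℕ ∣ ℕ.NonZero n ]

toℤ : ℕ⁺ → ℤ
toℤ n = + value n

infix 4 _<_ _>_

_<_ _>_ : Rel ℕ⁺ 0ℓ
x < y = value x ℕ.< value y
x > y = y < x

-- The list may contain repetitions and elements outside P: finiteness here
-- means being covered by a list, which does not presuppose that P is
-- decidable.
Finite : {A : Set} → Pred A 0ℓ → Set
Finite {A} P = ∃[ xs ] (∀ (x : A) → x ∈ P → x ∈ₗ xs)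

Infinite : {A : Set} → Pred A 0ℓ → Set
Infinite P = ¬ Finite P

2-Coloring : Set → Set
2-Coloring A = A → Bool

Monochromatic : {A : Set} → 2-Coloring A → Pred A 0ℓ → Set
Monochromatic {A} χ P = ∀ (x y : A) → x ∈ P → y ∈ P → χ x ≡ χ y

-- { m x + ℓ y + t : x , y ∈ B , x R y }, as a set of integers since t may be
-- negative.
forms : ℕ⁺ → ℕ⁺ → ℤ → Rel ℕ⁺ 0ℓ → Pred ℕ⁺ 0ℓ → Pred ℤ 0ℓ
forms m ℓ t R B z =
  ∃[ x ] ∃[ y ] (x ∈ B × y ∈ B × R x y × z ≡ toℤ m * toℤ x + toℤ ℓ * toℤ y + t)

{-# OPTIONS --safe #-}
module Submission where

-- By symmetry (exchange x with y, t₁ with t₂ and the coefficients) let b < a be the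
-- two coefficients, with a on the larger variable in the first form and b on
-- it in the second.  Colour n by the parity of its rank, the number of steps
-- that n ↦ ⌊ b n / a ⌋ takes to reach 0; this is a discrete version of the
-- logarithm of n to the base a / b.  The rank obeys two comparison rules:
--
--   b n ≤ a m          implies  rank n ≤ 1 + rank m   (rank-upper),
--   a m ≤ b n, n ≢ 0   implies  1 + rank m ≤ rank n   (rank-lower).
--
-- Choose x₁, x₂, y in B with x₁ large, x₂ much larger than x₁, and y much
-- larger than x₂, and consider the elements
--
--   n₁ = b x₁ + a y + t₁,   n₂ = b x₂ + a y + t₁,   m = b y + a x₁ + t₂.
--
-- The terms in y of b n₁, b n₂ and a m agree, so these numbers are ordered by
-- their terms b² x₁, b² x₂ and a² x₁: since b² x₁ < a² x₁ < b² x₂, it follows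
-- that b n₁ ≤ a m ≤ b n₂.  Moreover b n₂ ≤ a n₁, because y is large.  Hence
--
--   rank n₁ ≤ 1 + rank m ≤ rank n₂ ≤ 1 + rank n₁.
--
-- If the three ranks had the same parity, then the first and the last
-- inequality would sharpen to rank n₁ ≤ rank m and rank n₂ ≤ rank n₁,
-- contradicting the middle one.

open import Defs
open import Algebra.Bundles using (AbelianGroup)
open import Data.Bool.Base using (Bool; true; not)
open import Data.Bool.Properties using (not-¬)
open import Data.Empty using (⊥)
open import Data.Integer.Base using (ℤ; Positive; +_; +[1+_]; ∣_∣)
import Data.Integer.Base as ℤ
import Data.Integer.Properties as ℤ
open import Data.Irrelevant using ([_])
open import Data.List.Base using (map; upTo)
open import Data.List.Membership.Propositional using () renaming (_∈_ to _∈ₗ_)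
open import Data.List.Membership.Propositional.Properties using (∈-map⁺; ∈-upTo⁺)
open import Data.Nat.Base as ℕ using (ℕ; zero; suc; _+_; _*_; _/_; _≤_; NonZero; z≤n; s≤s)
open import Data.Nat.DivMod using (/-monoˡ-≤; m*n/n≡m; m<n*o⇒m/o<n)
open import Data.Nat.Properties
open import Data.Nat.Tactic.RingSolver using (solve-∀)
open import Data.Product.Base using (Σ-syntax; ∃-syntax; _×_; _,_)
open import Data.Refinement using (value; _,_)
open import Data.Sum.Base using (inj₁; inj₂)
open import Function.Base using (flip)
open import Level using (0ℓ)
open import Relation.Binary.Definitions using (tri<; tri≈; tri>)
open import Relation.Binary.PropositionalEquality.Core
  using (_≡_; _≢_; refl; sym; trans; cong; cong₂; subst)
open import Relation.Nullary.Negation.Core using (¬_; contradiction)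
open import Relation.Unary using (Pred; _∈_; _∪_; _⊆_; _⊢_)

-- Rank and its parity

isEven : ℕ → Bool
isEven zero    = true
isEven (suc n) = not (isEven n)

same-parity⇒≤ : ∀ {m n} → isEven m ≡ isEven n → m ≤ suc n → m ≤ n
same-parity⇒≤ eq m≤1+n with m≤n⇒m<n∨m≡n m≤1+n
... | inj₁ (s≤s m≤n) = m≤n
... | inj₂ refl      = contradiction (sym eq) (not-¬ refl)

-- The definitions take the divisor a before b; the inequality b < a is needed
-- only for their properties.
module _ (a b : ℕ) .{{_ : NonZero a}} where

  shrink : ℕ → ℕ
  shrink n = b * n / a

  -- The number of steps, but at most the first argument, that shrink takes
  -- to bring n to 0.
  rankWithin : ℕ → ℕ → ℕ
  rankWithin zero       n       = 0
  rankWithin (suc fuel) zero    = 0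
  rankWithin (suc fuel) (suc n) = suc (rankWithin fuel (shrink (suc n)))

  -- When b < a, shrink lowers every positive number, so that n steps suffice.
  rank : ℕ → ℕ
  rank n = rankWithin n n

  shrink-mono : ∀ {m n} → m ≤ n → shrink m ≤ shrink n
  shrink-mono m≤n = /-monoˡ-≤ a (*-monoʳ-≤ b m≤n)

  a*n/a≡n : ∀ n → a * n / a ≡ n
  a*n/a≡n n = trans (cong (_/ a) (*-comm a n)) (m*n/n≡m n a)

  shrink-upper : ∀ {m n} → b * n ≤ a * m → shrink n ≤ m
  shrink-upper {m} bn≤am = ≤-trans (/-monoˡ-≤ a bn≤am) (≤-reflexive (a*n/a≡n m))

  shrink-lower : ∀ {m n} → a * m ≤ b * n → m ≤ shrink n
  shrink-lower {m} am≤bn = ≤-trans (≤-reflexive (sym (a*n/a≡n m))) (/-monoˡ-≤ a am≤bn)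

  module _ (b<a : b ℕ.< a) where

    shrink-< : ∀ n → shrink (suc n) ℕ.< suc n
    shrink-< n = m<n*o⇒m/o<n
      (<-≤-trans (*-monoˡ-< (suc n) b<a) (≤-reflexive (*-comm a (suc n))))

    -- Only the bound on the right has to be large enough.
    rankWithin-mono : ∀ f g {m n} → n ≤ g → m ≤ n → rankWithin f m ≤ rankWithin g n
    rankWithin-mono zero    g                 n≤g       m≤n = z≤n
    rankWithin-mono (suc f) g       {zero}    n≤g       m≤n = z≤n
    rankWithin-mono (suc f) (suc g) {suc m} {suc n} (s≤s n≤g) m≤n =
      s≤s (rankWithin-mono f g (≤-trans (≤-pred (shrink-< n)) n≤g) (shrink-mono m≤n))

    rank-upper : ∀ m n → b * n ≤ a * m → rank n ≤ suc (rank m)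
    rank-upper m zero    _     = z≤n
    rank-upper m (suc n) bn≤am = s≤s (rankWithin-mono n m ≤-refl (shrink-upper bn≤am))

    rank-lower : ∀ m n .{{_ : NonZero n}} → a * m ≤ b * n → suc (rank m) ≤ rank n
    rank-lower m (suc n) am≤bn =
      s≤s (rankWithin-mono m n (≤-pred (shrink-< n)) (shrink-lower am≤bn))

    rank-parities : ∀ n₁ m n₂ .{{_ : NonZero n₂}} →
      b * n₁ ≤ a * m → a * m ≤ b * n₂ → b * n₂ ≤ a * n₁ →
      isEven (rank n₁) ≡ isEven (rank m) → isEven (rank n₂) ≡ isEven (rank n₁) → ⊥
    rank-parities n₁ m n₂ p q r e e′ = <-irrefl refl (begin-strict
      rank m   <⟨ rank-lower m n₂ q ⟩
      rank n₂  ≤⟨ same-parity⇒≤ e′ (rank-upper n₁ n₂ r) ⟩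
      rank n₁  ≤⟨ same-parity⇒≤ e (rank-upper m n₁ p) ⟩
      rank m   ∎)
      where open ≤-Reasoning

-- Comparison of large values of the two forms

-- The numbers u and n differ by at most T.
Near : ℕ → ℕ → ℕ → Set
Near T u n = n ≤ u + T × u ≤ n + T

-- An inequality between multiples of u and v, with enough room to spare, passes
-- to numbers near u and v.
Near-scale : ∀ c d T {u v n m} → Near T u n → Near T v m →
  c * u + (d + c) * T ≤ d * v → c * n ≤ d * m
Near-scale c d T {u} {v} {n} {m} (n≤u+T , _) (_ , v≤m+T) gap =
  +-cancelʳ-≤ (d * T) (c * n) (d * m) (begin
    c * n + d * T        ≤⟨ +-monoˡ-≤ (d * T) (*-monoʳ-≤ c n≤u+T) ⟩
    c * (u + T) + d * T  ≡⟨ rearrange c d u T ⟩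
    c * u + (d + c) * T  ≤⟨ gap ⟩
    d * v                ≤⟨ *-monoʳ-≤ d v≤m+T ⟩
    d * (m + T)          ≡⟨ *-distribˡ-+ d m T ⟩
    d * m + d * T        ∎)
  where
  open ≤-Reasoning
  rearrange : ∀ c d u T → c * (u + T) + d * T ≡ c * u + (d + c) * T
  rearrange = solve-∀

module _ {a b : ℕ} .{{_ : NonZero a}} .{{_ : NonZero b}} (b<a : b ℕ.< a) (T : ℕ) where
  open ≤-Reasoning

  -- The next three lemmas compare multiples of numbers that agree, up to an
  -- error T, with values of b x + a y or of b y + a x.

  -- Here a² ≥ b² + (a + b), as a ≥ b + 1, and the surplus (a + b) x absorbs
  -- the error.
  below-mixed : ∀ x y {n m} → T ≤ x →
    Near T (b * x + a * y) n → Near T (b * y + a * x) m → b * n ≤ a * m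
  below-mixed x y T≤x n~ m~ = Near-scale b a T n~ m~ (begin
    b * (b * x + a * y) + (a + b) * T  ≤⟨ +-monoʳ-≤ (b * (b * x + a * y)) (*-monoʳ-≤ (a + b) T≤x) ⟩
    b * (b * x + a * y) + (a + b) * x  ≡⟨ lhs a b x y ⟩
    (a + b * suc b) * x + a * (b * y)  ≤⟨ +-monoˡ-≤ (a * (b * y)) (*-monoˡ-≤ x (+-monoʳ-≤ a (*-monoʳ-≤ b b<a))) ⟩
    (suc b * a) * x + a * (b * y)      ≤⟨ +-monoˡ-≤ (a * (b * y)) (*-monoˡ-≤ x (*-monoˡ-≤ a b<a)) ⟩
    (a * a) * x + a * (b * y)          ≡⟨ rhs a b x y ⟩
    a * (b * y + a * x)                ∎)
    where
    lhs : ∀ a b x y →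
      b * (b * x + a * y) + (a + b) * x ≡ (a + b * suc b) * x + a * (b * y)
    lhs = solve-∀
    rhs : ∀ a b x y → (a * a) * x + a * (b * y) ≡ a * (b * y + a * x)
    rhs = solve-∀

  -- As b is positive, b (b x₂) ≥ x₂.
  mixed-below : ∀ x₁ x₂ y {n m} → a * a * x₁ + (a + b) * T ≤ x₂ →
    Near T (b * y + a * x₁) m → Near T (b * x₂ + a * y) n → a * m ≤ b * n
  mixed-below x₁ x₂ y x₂-large m~ n~ = Near-scale a b T m~ n~ (begin
    a * (b * y + a * x₁) + (b + a) * T            ≡⟨ lhs a b x₁ y T ⟩
    a * a * x₁ + (a + b) * T + b * (a * y)        ≤⟨ +-monoˡ-≤ (b * (a * y)) x₂-large ⟩
    x₂ + b * (a * y)                              ≤⟨ +-monoˡ-≤ (b * (a * y)) (≤-trans (m≤n*m x₂ b) (m≤n*m (b * x₂) b)) ⟩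
    b * (b * x₂) + b * (a * y)                    ≡⟨ *-distribˡ-+ b (b * x₂) (a * y) ⟨
    b * (b * x₂ + a * y)                          ∎)
    where
    lhs : ∀ a b x y T →
      a * (b * y + a * x) + (b + a) * T ≡ a * a * x + (a + b) * T + b * (a * y)
    lhs = solve-∀

  -- As a ≥ b + 1, a (a y) exceeds b (a y) by at least a y, hence by at least y.
  scaled-below : ∀ x₁ x₂ y {n₁ n₂} → b * b * x₂ + (a + b) * T ≤ y →
    Near T (b * x₂ + a * y) n₂ → Near T (b * x₁ + a * y) n₁ → b * n₂ ≤ a * n₁
  scaled-below x₁ x₂ y y-large n₂~ n₁~ = Near-scale b a T n₂~ n₁~ (begin
    b * (b * x₂ + a * y) + (a + b) * T      ≡⟨ lhs a b x₂ y T ⟩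
    b * b * x₂ + (a + b) * T + b * (a * y)  ≤⟨ +-monoˡ-≤ (b * (a * y)) (≤-trans y-large (m≤n*m y a)) ⟩
    suc b * (a * y)                         ≤⟨ *-monoˡ-≤ (a * y) b<a ⟩
    a * (a * y)                             ≤⟨ *-monoʳ-≤ a (m≤n+m (a * y) (b * x₁)) ⟩
    a * (b * x₁ + a * y)                    ∎)
    where
    lhs : ∀ a b x y T →
      b * (b * x + a * y) + (a + b) * T ≡ b * b * x + (a + b) * T + b * (a * y)
    lhs = solve-∀

-- Elements of infinite sets and of the forms

-- Infinite is a negation, so that a large element is available only when
-- proving a negation.
Infinite⇒¬¬large : ∀ {B} → Infinite B → ∀ N →
  ¬ (∀ (x : ℕ⁺) → x ∈ B → ¬ N ℕ.< value x)
Infinite⇒¬¬large infinite N none-large =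
  infinite (map sucℕ⁺ (upTo N) , λ x x∈B → covered x (≮⇒≥ (none-large x x∈B)))
  where
  sucℕ⁺ : ℕ → ℕ⁺
  sucℕ⁺ n = suc n , [ _ ]

  covered : ∀ (x : ℕ⁺) → value x ≤ N → x ∈ₗ map sucℕ⁺ (upTo N)
  covered (suc n , _) 1+n≤N = ∈-map⁺ sucℕ⁺ (∈-upTo⁺ 1+n≤N)
  covered (zero , [ () ])

+-near : ∀ {u n} t → + n ≡ + u ℤ.+ t → Near ∣ t ∣ u n
+-near {u} {n} t n≡u+t = upper , lower
  where
  open ≤-Reasoning
  upper : n ≤ u + ∣ t ∣
  upper = begin
    n              ≡⟨ cong ∣_∣ n≡u+t ⟩
    ∣ + u ℤ.+ t ∣  ≤⟨ ℤ.∣i+j∣≤∣i∣+∣j∣ (+ u) t ⟩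
    u + ∣ t ∣      ∎
  lower : u ≤ n + ∣ t ∣
  lower = begin
    u                      ≡⟨ cong ∣_∣ (//-rightDividesʳ t (+ u)) ⟨
    ∣ + u ℤ.+ t ℤ.- t ∣    ≡⟨ cong (λ i → ∣ i ℤ.- t ∣) n≡u+t ⟨
    ∣ + n ℤ.- t ∣          ≤⟨ ℤ.∣i-j∣≤∣i∣+∣j∣ (+ n) t ⟩
    n + ∣ t ∣              ∎
    where
    open import Algebra.Properties.Group (AbelianGroup.group ℤ.+-0-abelianGroup)
      using (//-rightDividesʳ)

Near-weaken : ∀ {S T u n} → S ≤ T → Near S u n → Near T u n
Near-weaken {u = u} {n} S≤T (p , q) =
  ≤-trans p (+-monoʳ-≤ u S≤T) , ≤-trans q (+-monoʳ-≤ n S≤T)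

Positive⇒ℕ⁺ : ∀ z → Positive z → ∃[ n ] (toℤ n ≡ z)
Positive⇒ℕ⁺ +[1+ n ] _ = (suc n , [ _ ]) , refl

-- Positivity of all elements of S turns an integer value of a form into a
-- positive natural number, to which the colouring applies.
forms-element : ∀ m ℓ t {R B} {S : Pred ℤ 0ℓ} → S ⊆ Positive → forms m ℓ t R B ⊆ S →
  ∀ {T} → ∣ t ∣ ≤ T → ∀ x y → x ∈ B → y ∈ B → R x y →
  ∃[ n ] (toℤ n ∈ S × Near T (value m * value x + value ℓ * value y) (value n))
forms-element m ℓ t {S = S} S⊆Positive forms⊆S t≤T x y x∈B y∈B xRy
  with z∈S ← forms⊆S (x , y , x∈B , y∈B , xRy , refl)
  with n , n≡z ← Positive⇒ℕ⁺ _ (S⊆Positive z∈S) =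
  n , subst S (sym n≡z) z∈S ,
  Near-weaken t≤T (+-near t (trans n≡z (cong (ℤ._+ t) (sym (trans
    (ℤ.pos-+ (value m * value x) (value ℓ * value y))
    (cong₂ ℤ._+_ (ℤ.pos-* (value m) (value x)) (ℤ.pos-* (value ℓ) (value y))))))))

-- The colouring

-- The colour is the parity of the rank; a is the larger coefficient.
rankColoring : (a b : ℕ) .{{_ : NonZero a}} → 2-Coloring ℕ⁺
rankColoring a b n = isEven (rank a b (value n))

ℕ⁺-nonZero : (n : ℕ⁺) → NonZero (value n)
ℕ⁺-nonZero (suc n , _) = _
ℕ⁺-nonZero (zero , [ () ])

rankColoring-not-monochromatic :
  ∀ (a b : ℕ⁺) .{{_ : NonZero (value a)}} → b < a → ∀ (B : Pred ℕ⁺ 0ℓ) → Infinite B → ∀ t₁ t₂ →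
  forms b a t₁ _<_ B ∪ forms b a t₂ _>_ B ⊆ Positive →
  ¬ Monochromatic (rankColoring (value a) (value b))
      (toℤ ⊢ (forms b a t₁ _<_ B ∪ forms b a t₂ _>_ B))
rankColoring-not-monochromatic a⁺ b⁺ b<a B infinite t₁ t₂ S⊆Positive mono =
  large T λ x₁ x₁∈B x₁> →
  large (value x₁ + (a * a * value x₁ + (a + b) * T)) λ x₂ x₂∈B x₂> →
  large (value x₂ + (b * b * value x₂ + (a + b) * T)) λ y y∈B y> →
  let
    x₁<x₂ = ≤-<-trans (m≤m+n (value x₁) _) x₂>
    x₂<y  = ≤-<-trans (m≤m+n (value x₂) _) y>
    x₁<y  = <-trans x₁<x₂ x₂<y
    x₂-large = <⇒≤ (≤-<-trans (m≤n+m _ (value x₁)) x₂>)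
    y-large  = <⇒≤ (≤-<-trans (m≤n+m _ (value x₂)) y>)
    n₁ , n₁∈S , n₁~ = element₁ x₁ y x₁∈B y∈B x₁<y
    n₂ , n₂∈S , n₂~ = element₁ x₂ y x₂∈B y∈B x₂<y
    m  , m∈S  , m~  = element₂ y x₁ y∈B x₁∈B x₁<y
  in rank-parities a b b<a (value n₁) (value m) (value n₂) {{ℕ⁺-nonZero n₂}}
       (below-mixed b<a T (value x₁) (value y) (<⇒≤ x₁>) n₁~ m~)
       (mixed-below b<a T (value x₁) (value x₂) (value y) x₂-large m~ n₂~)
       (scaled-below b<a T (value x₁) (value x₂) (value y) y-large n₂~ n₁~)
       (mono n₁ m n₁∈S m∈S) (mono n₂ n₁ n₂∈S n₁∈S)
  where
  a b T : ℕ
  a = value a⁺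
  b = value b⁺
  T = ∣ t₁ ∣ + ∣ t₂ ∣

  instance
    b≢0 : NonZero b
    b≢0 = ℕ⁺-nonZero b⁺

  large = Infinite⇒¬¬large infinite
  element₁ = forms-element b⁺ a⁺ t₁ S⊆Positive inj₁ (m≤m+n ∣ t₁ ∣ ∣ t₂ ∣)
  element₂ = forms-element b⁺ a⁺ t₂ S⊆Positive inj₂ (m≤n+m ∣ t₂ ∣ ∣ t₁ ∣)

-- Exchanging the two coefficients

forms-swap : ∀ m ℓ t R B → forms m ℓ t R B ⊆ forms ℓ m t (flip R) B
forms-swap m ℓ t R B (x , y , x∈B , y∈B , xRy , refl) =
  y , x , y∈B , x∈B , xRy ,
  cong (ℤ._+ t) (ℤ.+-comm (toℤ m ℤ.* toℤ x) (toℤ ℓ ℤ.* toℤ y))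

∪-forms-swap : ∀ m ℓ t₁ t₂ B →
  forms m ℓ t₁ _<_ B ∪ forms m ℓ t₂ _>_ B ⊆ forms ℓ m t₂ _<_ B ∪ forms ℓ m t₁ _>_ B
∪-forms-swap m ℓ t₁ t₂ B (inj₁ z∈) = inj₂ (forms-swap m ℓ t₁ _<_ B z∈)
∪-forms-swap m ℓ t₁ t₂ B (inj₂ z∈) = inj₁ (forms-swap m ℓ t₂ _>_ B z∈)

value-injective : ∀ {m n : ℕ⁺} → value m ≡ value n → m ≡ n
value-injective refl = refl

proposition5p2 : ∀ (ℓ m : ℕ⁺) → ℓ ≢ m →
    Σ[ χ ∈ 2-Coloring ℕ⁺ ] (∀ (B : Pred ℕ⁺ 0ℓ) → Infinite B → ∀ (t₁ t₂ : ℤ) →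
    forms m ℓ t₁ _<_ B ∪ forms m ℓ t₂ _>_ B ⊆ Positive →
    ¬ Monochromatic χ (toℤ ⊢ (forms m ℓ t₁ _<_ B ∪ forms m ℓ t₂ _>_ B)))
proposition5p2 ℓ m ℓ≢m with <-cmp (value m) (value ℓ)
... | tri< m<ℓ _ _ =
  let instance _ = ℕ⁺-nonZero ℓ in
  rankColoring (value ℓ) (value m) , rankColoring-not-monochromatic ℓ m m<ℓ
... | tri≈ _ m≡ℓ _ = contradiction (sym (value-injective m≡ℓ)) ℓ≢m
... | tri> _ _ ℓ<m =
  let instance _ = ℕ⁺-nonZero m in
  rankColoring (value m) (value ℓ) , λ B infinite t₁ t₂ S⊆Positive mono →
  rankColoring-not-monochromatic m ℓ ℓ<m B infinite t₂ t₁
    (λ z∈ → S⊆Positive (∪-forms-swap ℓ m t₂ t₁ B z∈))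
    (λ x y x∈ y∈ → mono x y (∪-forms-swap ℓ m t₂ t₁ B x∈) (∪-forms-swap ℓ m t₂ t₁ B y∈))
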